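{- Let $\sigma$ be an sp-formula that contains the diamond $\Diamond_S$ but does not contain $\Diamond_R$, and let $q$ be a propositional variable not occurring in $\sigma$. Then the spi-logic $\mathsf{SPi}+\{\Diamond_R\sigma\to q\}$ is incomplete.
   Context: Multimodal setting with a signature of relation symbols and diamonds $\Diamond_R$. Sp-formulas: built from propositional variables and $\top$ by $\wedge$ and the diamonds; sp-implications $\sigma\to\tau$. A SLO is an algebra $(A,\wedge,\top,\Diamond_R)_R$ with $(A,\wedge,\top)$ a meet-semilattice with top and each $\Diamond_R$ monotone; it validates $\sigma\to\tau$ if $\sigma[\mathfrak a]\le\tau[\mathfrak a]$ for all valuations. Frames $(W,R^{\mathfrak F})_R$ with standard Kripke semantics. $\Sigma\models_{\mathsf{Kr}}\iota$ (resp. $\models_{\mathsf{SLO}}$): valid in all frames (resp. SLOs) validating $\Sigma$. $\mathsf{SPi}+\Sigma$ is complete if $\Sigma\models_{\mathsf{Kr}}\iota\iff\Sigma\models_{\mathsf{SLO}}\iota$ for every sp-implication $\iota$, and incomplete otherwise. -}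

module Defs where

open import Level using (0ℓ) renaming (suc to lsuc)
open import Algebra.Lattice.Bundles using (BoundedMeetSemilattice)
open import Data.Nat using (ℕ)
open import Data.Product using (Σ-syntax; _×_)
import Data.Unit as Unit
open import Function.Bundles using (_⇔_)
open import Relation.Binary.Core using (Rel)
import Relation.Binary.Construct.NaturalOrder.Left as NaturalOrder
open import Relation.Nullary using (¬_)
open import Relation.Unary using (Pred)

Var : Set
Var = ℕ

infixr 7 _∧_
infix  4 _⟶_
infix  4 _⊨Kr_ _⊨SLO_

data SpFormula (Sig : Set) : Set where
  var : Var → SpFormula Sig
  ⊤   : SpFormula Sig
  _∧_ : SpFormula Sig → SpFormula Sig → SpFormula Sig
  ◇   : Sig → SpFormula Sig → SpFormula Sig

record SpImplication (Sig : Set) : Set where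
  constructor _⟶_
  field
    antecedent : SpFormula Sig
    consequent : SpFormula Sig

data VarOccurs {Sig : Set} (p : Var) : SpFormula Sig → Set where
  here : VarOccurs p (var p)
  ∧ˡ   : ∀ {σ τ} → VarOccurs p σ → VarOccurs p (σ ∧ τ)
  ∧ʳ   : ∀ {σ τ} → VarOccurs p τ → VarOccurs p (σ ∧ τ)
  ◇-in : ∀ {T σ} → VarOccurs p σ → VarOccurs p (◇ T σ)

data DiamondOccurs {Sig : Set} (R : Sig) : SpFormula Sig → Set where
  here : ∀ {σ} → DiamondOccurs R (◇ R σ)
  ∧ˡ   : ∀ {σ τ} → DiamondOccurs R σ → DiamondOccurs R (σ ∧ τ)
  ∧ʳ   : ∀ {σ τ} → DiamondOccurs R τ → DiamondOccurs R (σ ∧ τ)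
  ◇-in : ∀ {T σ} → DiamondOccurs R σ → DiamondOccurs R (◇ T σ)

record Frame (Sig : Set) : Set₁ where
  field
    W   : Set
    rel : Sig → Rel W 0ℓ

module _ {Sig : Set} (F : Frame Sig) where
  open Frame F

  forces : (Var → Pred W 0ℓ) → W → SpFormula Sig → Set
  forces V w (var p) = V p w
  forces V w ⊤       = Unit.⊤
  forces V w (σ ∧ τ) = forces V w σ × forces V w τ
  forces V w (◇ R σ) = Σ[ v ∈ W ] (rel R w v × forces V v σ)

  FrameValidates : SpImplication Sig → Set₁
  FrameValidates (σ ⟶ τ) =
    (V : Var → Pred W 0ℓ) (w : W) → forces V w σ → forces V w τ

-- The carrier lives in Set₁ so that the complex algebra of every frame,
-- with carrier W → Set and pointwise logical equivalence as equality,
-- is an SLO.  Monotonicity of a diamond implies that it respects _≈_.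
record SLO (Sig : Set) : Set₂ where
  field
    semilattice : BoundedMeetSemilattice (lsuc 0ℓ) 0ℓ

  open BoundedMeetSemilattice semilattice public
    using (Carrier; _≈_)
    renaming (_∧_ to _⊓_; ⊤ to 𝟙)
  open NaturalOrder _≈_ _⊓_ public using (_≤_)

  field
    dia          : Sig → Carrier → Carrier
    dia-monotone : ∀ R {a b} → a ≤ b → dia R a ≤ dia R b

module _ {Sig : Set} (A : SLO Sig) where
  open SLO A

  eval : (Var → Carrier) → SpFormula Sig → Carrier
  eval a (var p) = a p
  eval a ⊤       = 𝟙
  eval a (σ ∧ τ) = eval a σ ⊓ eval a τ
  eval a (◇ R σ) = dia R (eval a σ)

  SLOValidates : SpImplication Sig → Set₁
  SLOValidates (σ ⟶ τ) = (a : Var → Carrier) → eval a σ ≤ eval a τ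

_⊨Kr_ : {Sig : Set} → Pred (SpImplication Sig) 0ℓ → SpImplication Sig → Set₁
_⊨Kr_ {Sig} Γ ι =
  (F : Frame Sig) → (∀ κ → Γ κ → FrameValidates F κ) → FrameValidates F ι

_⊨SLO_ : {Sig : Set} → Pred (SpImplication Sig) 0ℓ → SpImplication Sig → Set₂
_⊨SLO_ {Sig} Γ ι =
  (A : SLO Sig) → (∀ κ → Γ κ → SLOValidates A κ) → SLOValidates A ι

Complete : {Sig : Set} → Pred (SpImplication Sig) 0ℓ → Set₂
Complete {Sig} Γ = (ι : SpImplication Sig) → (Γ ⊨Kr ι) ⇔ (Γ ⊨SLO ι)

Incomplete : {Sig : Set} → Pred (SpImplication Sig) 0ℓ → Set₂
Incomplete Γ = ¬ Complete Γ

{-# OPTIONS --safe #-}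

-- Since q does not occur in σ, a frame validates ◇ R σ ⟶ var q only if ◇ R σ is
-- unsatisfiable in it, and then so is ◇ S (◇ R σ).  In an SLO the axiom merely makes
-- ◇ R σ the least element, and a diamond need not preserve the least element: in the
-- SLO of truth values in which ◇ R is constantly false and every other diamond is
-- constantly true, the axiom is valid but ◇ S (◇ R σ) ⟶ var q is not.
module Submission where

open import Defs
open import Data.Empty using (⊥)
open import Data.Product using (_×_; _,_; proj₁; proj₂; swap; map; assocʳ; assocˡ)
import Data.Unit as Unit
open import Algebra.Lattice.Bundles using (BoundedMeetSemilattice)
open import Function.Bundles using (_⇔_; mk⇔; Equivalence)
open import Function.Properties.Equivalence using (⇔-isEquivalence)
open import Level using (0ℓ) renaming (suc to lsuc)
open import Relation.Binary.PropositionalEquality using (_≢_; refl)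
open import Relation.Nullary using (¬_; contradiction)
open import Relation.Unary using (｛_｝; Pred)

-- The natural order `a ≤ b` unfolds to `a ⇔ (a × b)`, which amounts to implication.
×-⇔-boundedMeetSemilattice : BoundedMeetSemilattice (lsuc 0ℓ) 0ℓ
×-⇔-boundedMeetSemilattice = record
  { Carrier = Set
  ; _≈_     = _⇔_
  ; _∧_     = _×_
  ; ⊤       = Unit.⊤
  ; isBoundedMeetSemilattice = record
    { isCommutativeMonoid = record
      { isMonoid = record
        { isSemigroup = record
          { isMagma = record
            { isEquivalence = ⇔-isEquivalence
            ; ∙-cong        = λ f g → mk⇔ (map (to f) (to g)) (map (from f) (from g))
            }
          ; assoc = λ _ _ _ → mk⇔ assocʳ assocˡ
          }
        ; identity = (λ _ → mk⇔ proj₂ (Unit.tt ,_)) , (λ _ → mk⇔ proj₁ (_, Unit.tt))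
        }
      ; comm = λ _ _ → mk⇔ swap swap
      }
    ; idem = λ _ → mk⇔ proj₁ (λ a → a , a)
    }
  }
  where open Equivalence

-- With a predicate in place of a Boolean function, `_≢ R` can be used without deciding equality in
-- `Sig`.
constantDiamonds : {Sig : Set} → Pred Sig 0ℓ → SLO Sig
constantDiamonds P = record
  { semilattice  = ×-⇔-boundedMeetSemilattice
  ; dia          = λ T _ → P T
  ; dia-monotone = λ _ _ → mk⇔ (λ x → x , x) proj₁
  }

-- The conjunct `p ≢ q` falsifies `q` at every point and, up to equivalence, leaves the other
-- variables alone.
_without_ : {W : Set} → (Var → Pred W 0ℓ) → Var → Var → Pred W 0ℓ
(V without q) p w = V p w × p ≢ q

-- Forcing depends only on the variables that occur in `σ`, and each of these differs from `q`.
forces-without : ∀ {Sig : Set} (F : Frame Sig) (V : Var → Pred (Frame.W F) 0ℓ) {q : Var} →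
  ∀ σ {w} → ¬ VarOccurs q σ → forces F V w σ → forces F (V without q) w σ
forces-without F V (var p) q∉σ Vpw = Vpw , λ { refl → q∉σ here }
forces-without F V ⊤       q∉σ _   = Unit.tt
forces-without F V (σ ∧ τ) q∉σ (w⊩σ , w⊩τ) =
  forces-without F V σ (λ q∈σ → q∉σ (∧ˡ q∈σ)) w⊩σ ,
  forces-without F V τ (λ q∈τ → q∉σ (∧ʳ q∈τ)) w⊩τ
forces-without F V (◇ T σ) q∉σ (v , wTv , v⊩σ) =
  v , wTv , forces-without F V σ (λ q∈σ → q∉σ (◇-in q∈σ)) v⊩σ

-- A point forcing `σ` would still force it after `q` is made false everywhere, and validity would
-- then yield `q` there.
fresh-consequent⇒unsatisfiable : ∀ {Sig : Set} (F : Frame Sig) (σ : SpFormula Sig) {q : Var} →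
  ¬ VarOccurs q σ → FrameValidates F (σ ⟶ var q) → ∀ V w → ¬ forces F V w σ
fresh-consequent⇒unsatisfiable F σ {q} q∉σ valid V w w⊩σ =
  proj₂ (valid (V without q) w (forces-without F V σ q∉σ w⊩σ)) refl

theorem5p25 : (Sig : Set) (R S : Sig) (σ : SpFormula Sig) (q : Var) →
    DiamondOccurs S σ → ¬ DiamondOccurs R σ → ¬ VarOccurs q σ →
    Incomplete ｛ ◇ R σ ⟶ var q ｝
theorem5p25 Sig R S σ q S∈σ R∉σ q∉σ complete = proj₂ (Equivalence.to ◇S◇Rσ≤q S≢R)
  where
  S≢R : S ≢ R
  S≢R refl = R∉σ S∈σ

  kripke : ｛ ◇ R σ ⟶ var q ｝ ⊨Kr (◇ S (◇ R σ) ⟶ var q)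
  kripke F axioms V w (v , _ , v⊩◇Rσ) = contradiction v⊩◇Rσ
    (fresh-consequent⇒unsatisfiable F (◇ R σ) (λ { (◇-in q∈σ) → q∉σ q∈σ }) (axioms _ refl) V v)

  A : SLO Sig
  A = constantDiamonds (_≢ R)

  A-validates : ∀ κ → ｛ ◇ R σ ⟶ var q ｝ κ → SLOValidates A κ
  -- Under every valuation `◇ R σ` takes the value `R ≢ R`, which is absurd.
  A-validates _ refl a = mk⇔ (λ R≢R → contradiction refl R≢R) proj₁

  -- The outer diamond alone fixes the left value `S ≢ R`; the everywhere false valuation sends `q`
  -- to `⊥`.
  ◇S◇Rσ≤q : (S ≢ R) ⇔ ((S ≢ R) × ⊥)
  ◇S◇Rσ≤q = Equivalence.to (complete (◇ S (◇ R σ) ⟶ var q)) kripke A A-validates (λ _ → ⊥)
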